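{- Let $\mathcal{X}=(\Omega,S)$ be a pseudo-TI scheme with parameters $k$, $c$, and $m$. Suppose that $|S|>m+6c(k-1)$. Then $\mathcal{X}$ is schurian and separable.
   Context: A coherent configuration on a finite set $\Omega$ is a pair $\mathcal{X}=(\Omega,S)$, where $S$ is a partition of $\Omega\times\Omega$ such that: (C1) the diagonal $1_\Omega$ is a union of elements of $S$; (C2) for every $s\in S$, $s^*=\{(\beta,\alpha):(\alpha,\beta)\in s\}\in S$; (C3) for all $r,s,t\in S$ the number $c_{rs}^t=|\alpha r\cap\beta s^*|$ does not depend on $(\alpha,\beta)\in t$, where $\alpha r=\{\beta:(\alpha,\beta)\in r\}$. $\mathcal{X}$ is homogeneous if $1_\Omega\in S$; then each $s\in S$ has valency $n_s=|\alpha s|$, and $S_k=\{s\in S:n_s=k\}$. The indistinguishing number of $\mathcal{X}$ is $c=\max_{r\in S\setminus\{1_\Omega\}}\sum_{s\in S}c_{ss^*}^r$. A homogeneous coherent configuration with maximum valency $k$, indistinguishing number $c$ and $m=|S_1|$ is a pseudo-TI scheme with parameters $k,c,m$ if $S=S_1\cup S_k$ and $c\le mk$. $\mathcal{X}$ is schurian if $S$ is the set of orbits on $\Omega\times\Omega$ of some permutation group $G\le\mathrm{Sym}(\Omega)$ (acting componentwise). An algebraic isomorphism from $(\Omega,S)$ to $(\Omega',S')$ is a bijection $\varphi:S\to S'$ with $c_{rs}^t=c_{\varphi(r)\varphi(s)}^{\varphi(t)}$ for all $r,s,t$; $\mathcal{X}$ is separable if for every coherent configuration $\mathcal{X}'$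 and every algebraic isomorphism $\varphi:\mathcal{X}\to\mathcal{X}'$ there is a bijection $f:\Omega\to\Omega'$ with $\{(\alpha^f,\beta^f):(\alpha,\beta)\in s\}=\varphi(s)$ for all $s\in S$. -}

module Defs where

open import Data.Nat using (ℕ; zero; suc; _+_; _*_; _∸_; _≤_; _<_; _≡ᵇ_)
open import Data.Bool using (Bool; true; false; if_then_else_; _∧_)
open import Data.Fin using (Fin; zero; suc; _≟_)
open import Data.Product using (Σ; ∃; ∃-syntax; _×_; _,_)
open import Data.Sum using (_⊎_)
open import Function.Bundles using (_⇔_)
open import Relation.Nullary using (¬_)
open import Relation.Nullary.Decidable using (⌊_⌋)
open import Relation.Binary.PropositionalEquality using (_≡_)
open import Data.Fin.Permutation using (Permutation; Permutation′; _⟨$⟩ʳ_; _⟨$⟩ˡ_; id; _∘ₚ_; flip)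

count : ∀ {n} → (Fin n → Bool) → ℕ
count {zero}  p = 0
count {suc n} p = (if p zero then 1 else 0) + count (λ x → p (suc x))

sumF : ∀ {n} → (Fin n → ℕ) → ℕ
sumF {zero}  f = 0
sumF {suc n} f = f zero + sumF (λ x → f (suc x))

allF : ∀ {n} → (Fin n → Bool) → Bool
allF {zero}  p = true
allF {suc n} p = p zero ∧ allF (λ x → p (suc x))

-- Coherent configurations on Ω = Fin n.
-- The partition S of Ω×Ω into r (nonempty) classes is encoded by a
-- surjective colouring  col : Ω → Ω → Fin r ; class i is {(α,β) : col α β ≡ i}.
-- So |S| = r.

-- |α i ∩ β j*| = #{γ : (α,γ) ∈ i, (γ,β) ∈ j}
-- (γ ∈ β j*  iff  (β,γ) ∈ j*  iff  (γ,β) ∈ j)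
interNum : ∀ {n r} → (Fin n → Fin n → Fin r) → Fin n → Fin n → Fin r → Fin r → ℕ
interNum col α β i j = count (λ γ → ⌊ col α γ ≟ i ⌋ ∧ ⌊ col γ β ≟ j ⌋)

record CoherentConfiguration (n r : ℕ) : Set where
  field
    col  : Fin n → Fin n → Fin r
    surj : ∀ i → ∃[ α ] ∃[ β ] col α β ≡ i
    C1   : ∀ α β γ → col α β ≡ col γ γ → α ≡ β
    star : Fin r → Fin r
    C2   : ∀ i α β → (col α β ≡ i) ⇔ (col β α ≡ star i)
    C3   : ∀ i j α β α′ β′ → col α β ≡ col α′ β′ →
           interNum col α β i j ≡ interNum col α′ β′ i j

module _ {n r : ℕ} (X : CoherentConfiguration n r) where
  open CoherentConfiguration X

  rowCount : Fin n → Fin r → ℕ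
  rowCount α s = count (λ γ → ⌊ col α γ ≟ s ⌋)

  -- d is the class 1_Ω (homogeneity: 1_Ω ∈ S)
  IsDiagonalClass : Fin r → Set
  IsDiagonalClass d = ∀ α β → (col α β ≡ d) ⇔ (α ≡ β)

  HasValency : Fin r → ℕ → Set
  HasValency s k = ∀ α → rowCount α s ≡ k

  numValencyOne : ℕ
  numValencyOne = count (λ s → allF (λ α → rowCount α s ≡ᵇ 1))

  IsMaxValency : ℕ → Set
  IsMaxValency k = (∀ s → ∀ α → rowCount α s ≤ k) × (∃[ s ] HasValency s k)

  indistSum : Fin n → Fin n → ℕ
  indistSum α β = sumF (λ s → interNum col α β s (star s))

  IsIndistinguishingNumber : Fin r → ℕ → Set
  IsIndistinguishingNumber d c =
    (∀ α β → ¬ (col α β ≡ d) → indistSum α β ≤ c) ×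
    (∃[ α ] ∃[ β ] (¬ (col α β ≡ d) × indistSum α β ≡ c))

  -- pseudo-TI scheme with parameters k, c, m (d = 1_Ω, so X homogeneous)
  IsPseudoTI : Fin r → ℕ → ℕ → ℕ → Set
  IsPseudoTI d k c m =
    IsDiagonalClass d ×
    IsMaxValency k ×
    IsIndistinguishingNumber d c ×
    m ≡ numValencyOne ×
    (∀ s → HasValency s 1 ⊎ HasValency s k) ×
    c ≤ m * k

  record PermGroup : Set₁ where
    field
      mem    : Permutation′ n → Set
      mem-id : mem id
      mem-∘  : ∀ g h → mem g → mem h → mem (g ∘ₚ h)
      mem-⁻¹ : ∀ g → mem g → mem (flip g)

  Schurian : Set₁
  Schurian = Σ PermGroup λ G →
    ∀ α β α′ β′ → (col α β ≡ col α′ β′) ⇔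
      (∃[ g ] (PermGroup.mem G g × (g ⟨$⟩ʳ α ≡ α′) × (g ⟨$⟩ʳ β ≡ β′)))

IsAlgebraicIso : ∀ {n r n′ r′} → CoherentConfiguration n r →
  CoherentConfiguration n′ r′ → Permutation r r′ → Set
IsAlgebraicIso {n} {r} {n′} {r′} X X′ φ =
  ∀ (i j t : Fin r) (α β : Fin n) (α′ β′ : Fin n′) →
    CoherentConfiguration.col X α β ≡ t →
    CoherentConfiguration.col X′ α′ β′ ≡ φ ⟨$⟩ʳ t →
    interNum (CoherentConfiguration.col X) α β i j ≡
    interNum (CoherentConfiguration.col X′) α′ β′ (φ ⟨$⟩ʳ i) (φ ⟨$⟩ʳ j)

Separable : ∀ {n r} → CoherentConfiguration n r → Set
Separable {n} {r} X =
  ∀ (n′ r′ : ℕ) (X′ : CoherentConfiguration n′ r′) (φ : Permutation r r′) →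
    IsAlgebraicIso X X′ φ →
    Σ (Permutation n n′) λ f → ∀ (α β : Fin n) →
      CoherentConfiguration.col X′ ((f ⟨$⟩ʳ α)) (f ⟨$⟩ʳ β)
        ≡ φ ⟨$⟩ʳ CoherentConfiguration.col X α β

{-# OPTIONS --safe #-}
module Submission where

-- Let φ be an algebraic isomorphism X → X′; call (a, b) and (a′, b′) matched if φ maps the
-- colour of the first to that of the second. A pair of distinct points has at most c points
-- that fail to distinguish it. Hence, for a fixed α, each obstruction to deducing that a pair
-- is matched from triangles through a further point μ excludes at most k(k−1)c points μ,
-- and by the bound on |S| the points whose colour from α has valency k survive any six
-- such obstructions. So being matched propagates along chains β, γ, δ as soon as β
-- distinguishes the points of the α-fibre of γ, and γ those of the α-fibre of δ.
-- Starting from a matched pair (α, σ), (α′, σ′) whose colour has valency k, a generic chain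
-- σ, ν, γ then determines the image of every γ, and all pairs of points are matched.
-- This gives separability; for φ = id, with σ generic for α and β, it gives the
-- automorphisms that move (α, β) to any pair of the same colour.

open import Defs
open import Data.Nat using (ℕ; zero; suc; _+_; _*_; _∸_; _≤_; _<_; _≡ᵇ_; z≤n; s≤s; >-nonZero)
open import Data.Nat.Properties hiding (_≟_)
open import Algebra.Properties.CommutativeSemigroup +-commutativeSemigroup using (interchange)
open import Algebra.Properties.CommutativeSemigroup *-commutativeSemigroup using (x∙yz≈y∙xz)
open import Data.Bool using (Bool; true; false; if_then_else_; _∧_; not)
import Data.Bool.Properties as Bool
open import Data.Fin using (Fin; zero; suc; _≟_)
open import Data.Fin.Permutation using (Permutation; permutation; _⟨$⟩ʳ_; _⟨$⟩ˡ_; id; inverseˡ; inverseʳ)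
open import Data.List using (List; []; _∷_; length; filter; allFin; tabulate; concatMap)
open import Data.List.Properties using (length-++; filter-notAll)
open import Data.List.Membership.Propositional using (_∈_; _∉_; lose)
open import Data.List.Membership.Propositional.Properties using (∈-filter⁺; ∈-filter⁻; ∈-allFin; ∈-concatMap⁺)
open import Data.List.Relation.Unary.Any using (here; there)
open import Data.List.Relation.Unary.All as All using (All; []; _∷_)
open import Data.Product using (∃-syntax; ∃₂; _×_; _,_; proj₁; proj₂)
open import Data.Sum using (inj₁; inj₂)
open import Function using (_∘_)
open import Function.Bundles using (mk⇔; Equivalence)
open import Relation.Nullary using (¬_; Dec; yes; no; contradiction; ¬?)
open import Relation.Nullary.Decidable using (⌊_⌋)
open import Relation.Binary.PropositionalEquality using (_≡_; _≢_; refl; sym; trans; cong; cong₂; subst; module ≡-Reasoning)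

-- Counting in Fin n

⌊⌋-intro : ∀ {a} {A : Set a} (a? : Dec A) → A → ⌊ a? ⌋ ≡ true
⌊⌋-intro (yes _) _ = refl
⌊⌋-intro (no ¬a) a = contradiction a ¬a

⌊⌋-elim : ∀ {a} {A : Set a} (a? : Dec A) → ⌊ a? ⌋ ≡ true → A
⌊⌋-elim (yes a) _ = a

∧-intro : ∀ {b c} → b ≡ true → c ≡ true → b ∧ c ≡ true
∧-intro refl refl = refl

∧-elimˡ : ∀ {b c} → b ∧ c ≡ true → b ≡ true
∧-elimˡ {true} _ = refl

∧-elimʳ : ∀ {b c} → b ∧ c ≡ true → c ≡ true
∧-elimʳ {true} e = e

indicator : Bool → ℕ
indicator b = if b then 1 else 0

indicator-mono : ∀ {b c} → (b ≡ true → c ≡ true) → indicator b ≤ indicator c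
indicator-mono {false} h = z≤n
indicator-mono {true}  h rewrite h refl = ≤-refl

indicator≤1 : ∀ b → indicator b ≤ 1
indicator≤1 false = z≤n
indicator≤1 true  = ≤-refl

sumF-mono : ∀ {n} {f g : Fin n → ℕ} → (∀ x → f x ≤ g x) → sumF f ≤ sumF g
sumF-mono {zero}  h = z≤n
sumF-mono {suc n} h = +-mono-≤ (h zero) (sumF-mono (h ∘ suc))

sumF-+ : ∀ {n} (f g : Fin n → ℕ) → sumF (λ x → f x + g x) ≡ sumF f + sumF g
sumF-+ {zero}  f g = refl
sumF-+ {suc n} f g = trans (cong (f zero + g zero +_) (sumF-+ (f ∘ suc) (g ∘ suc)))
  (interchange (f zero) (g zero) (sumF (f ∘ suc)) (sumF (g ∘ suc)))

sumF-indicator-* : ∀ {n} (p : Fin n → Bool) k → sumF (λ x → indicator (p x) * k) ≡ count p * k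
sumF-indicator-* {zero}  p k = refl
sumF-indicator-* {suc n} p k =
  trans (cong (indicator (p zero) * k +_) (sumF-indicator-* (p ∘ suc) k))
        (sym (*-distribʳ-+ k (indicator (p zero)) (count (p ∘ suc))))

sumF-zero : ∀ n → sumF {n} (λ _ → 0) ≡ 0
sumF-zero zero    = refl
sumF-zero (suc n) = sumF-zero n

sumF-indicator : ∀ {n} (p : Fin n → Bool) → sumF (indicator ∘ p) ≡ count p
sumF-indicator {zero}  p = refl
sumF-indicator {suc n} p = cong (indicator (p zero) +_) (sumF-indicator (p ∘ suc))

double-count : ∀ {m n} (R : Fin m → Fin n → Bool) →
  sumF (λ x → count (R x)) ≡ sumF (λ y → count (λ x → R x y))
double-count {zero}  {n} R = sym (sumF-zero n)
double-count {suc m} {n} R = begin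
  count (R zero) + sumF (λ x → count (R (suc x)))
    ≡⟨ cong₂ _+_ (sym (sumF-indicator (R zero))) (double-count (R ∘ suc)) ⟩
  sumF (indicator ∘ R zero) + sumF (λ y → count (λ x → R (suc x) y))
    ≡⟨ sym (sumF-+ (indicator ∘ R zero) _) ⟩
  sumF (λ y → count (λ x → R x y)) ∎
  where open ≡-Reasoning

count-mono : ∀ {n} (p q : Fin n → Bool) → (∀ x → p x ≡ true → q x ≡ true) → count p ≤ count q
count-mono {zero}  p q h = z≤n
count-mono {suc n} p q h =
  +-mono-≤ (indicator-mono (h zero)) (count-mono (p ∘ suc) (q ∘ suc) (h ∘ suc))

count-not : ∀ {n} (p : Fin n → Bool) → count p + count (not ∘ p) ≡ n
count-not {zero}  p = refl
count-not {suc n} p with p zero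
... | true  = cong suc (count-not (p ∘ suc))
... | false = trans (+-suc _ _) (cong suc (count-not (p ∘ suc)))

count-positive : ∀ {n} (p : Fin n → Bool) {x} → p x ≡ true → 0 < count p
count-positive p {zero}  e rewrite e = s≤s z≤n
count-positive p {suc x} e = ≤-trans (count-positive (p ∘ suc) e) (m≤n+m _ _)

count-witness : ∀ {n} (p : Fin n → Bool) → 0 < count p → ∃[ x ] p x ≡ true
count-witness {suc n} p h with p zero in e
... | true  = zero , e
... | false = let x , e′ = count-witness (p ∘ suc) h in suc x , e′

count≥2 : ∀ {n} (p : Fin n → Bool) {x y} → p x ≡ true → p y ≡ true → x ≢ y → 2 ≤ count p
count≥2 p {zero}  {zero}  _ _ x≢y = contradiction refl x≢y
count≥2 p {zero}  {suc y} e f _ rewrite e = s≤s (count-positive (p ∘ suc) f)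
count≥2 p {suc x} {zero}  e f _ rewrite f = s≤s (count-positive (p ∘ suc) e)
count≥2 p {suc x} {suc y} e f x≢y =
  ≤-trans (count≥2 (p ∘ suc) e f (x≢y ∘ cong suc)) (m≤n+m _ _)

count-remove : ∀ {n} (p : Fin n → Bool) b → count p ≤ suc (count (λ x → p x ∧ not ⌊ x ≟ b ⌋))
count-remove p zero = +-mono-≤ (indicator≤1 (p zero))
  (≤-trans (count-mono (p ∘ suc) (λ x → p (suc x) ∧ true) λ x e → ∧-intro e refl) (m≤n+m _ _))
count-remove p (suc b) = begin
  indicator (p zero) + count (p ∘ suc)
    ≤⟨ +-mono-≤ (indicator-mono λ e → ∧-intro e refl) (count-remove (p ∘ suc) b) ⟩
  _ + suc (count (λ x → p (suc x) ∧ not ⌊ x ≟ b ⌋))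
    ≡⟨ +-suc _ _ ⟩
  suc (_ + count (λ x → p (suc x) ∧ not ⌊ x ≟ b ⌋))
    ≤⟨ s≤s (+-monoʳ-≤ _ (count-mono _ _ λ x e →
         ∧-intro (∧-elimˡ e) (≟-suc x (∧-elimʳ {p (suc x)} e)))) ⟩
  suc (count (λ x → p x ∧ not ⌊ x ≟ suc b ⌋)) ∎
  where
  open ≤-Reasoning
  ≟-suc : ∀ x → not ⌊ x ≟ b ⌋ ≡ true → not ⌊ suc x ≟ suc b ⌋ ≡ true
  ≟-suc x e with x ≟ b
  ... | no _ = refl

choose-outside : ∀ {n} (bs : List (Fin n)) (p : Fin n → Bool) → length bs < count p →
  ∃[ x ] p x ≡ true × x ∉ bs
choose-outside []       p h = let x , e = count-witness p h in x , e , λ ()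
choose-outside (b ∷ bs) p h =
  let x , e , x∉bs = choose-outside bs _ (≤-pred (≤-trans h (count-remove p b)))
  in x , ∧-elimˡ e , λ
    { (here x≡b) → not-removed x≡b (∧-elimʳ {p x} e)
    ; (there x∈bs) → x∉bs x∈bs }
  where
  not-removed : ∀ {x} → x ≡ b → ¬ (not ⌊ x ≟ b ⌋ ≡ true)
  not-removed {x} x≡b e rewrite ⌊⌋-intro (x ≟ b) x≡b = contradiction e λ ()

count≤1 : ∀ {n} (p : Fin n → Bool) → (∀ {x y} → p x ≡ true → p y ≡ true → x ≡ y) → count p ≤ 1
count≤1 p unique with count p ≤? 1
... | yes le = le
... | no ¬le =
  let x , e , _ = choose-outside [] p (≤-trans (s≤s z≤n) (≰⇒> ¬le))
      y , f , y∉ = choose-outside (x ∷ []) p (≰⇒> ¬le)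
  in contradiction (here (unique f e)) y∉

count≤indicator : ∀ {n} (p : Fin n → Bool) b → (∀ {x} → p x ≡ true → b ≡ true) →
  (∀ {x y} → p x ≡ true → p y ≡ true → x ≡ y) → count p ≤ indicator b
count≤indicator p true  _ unique = count≤1 p unique
count≤indicator p false h _ = ≮⇒≥ λ pos → contradiction (h (proj₂ (count-witness p pos))) λ ()

length-filter-tabulate : ∀ {n} {A : Set} {P : A → Set} (P? : ∀ x → Dec (P x)) (f : Fin n → A) →
  length (filter P? (tabulate f)) ≡ count (λ x → ⌊ P? (f x) ⌋)
length-filter-tabulate {zero}  P? f = refl
length-filter-tabulate {suc n} P? f with P? (f zero)
... | yes _ = cong suc (length-filter-tabulate P? (f ∘ suc))
... | no _  = length-filter-tabulate P? (f ∘ suc)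

length-concatMap-≤ : ∀ {A B : Set} (f : A → List B) {b} (xs : List A) →
  (∀ {x} → x ∈ xs → length (f x) ≤ b) → length (concatMap f xs) ≤ length xs * b
length-concatMap-≤ f []       h = z≤n
length-concatMap-≤ f (x ∷ xs) h rewrite length-++ (f x) {concatMap f xs} =
  +-mono-≤ (h (here refl)) (length-concatMap-≤ f xs (h ∘ there))

∈-concatMap : ∀ {A B : Set} (f : A → List B) {x y xs} → x ∈ xs → y ∈ f x → y ∈ concatMap f xs
∈-concatMap f x∈xs y∈fx = ∈-concatMap⁺ f (lose x∈xs y∈fx)

-- Double count the pairs `(s, x)` with `h x ≡ s` and `q s` true: such an `s` has at least `k`
-- partners, an `x` at most one.
count-fibres : ∀ {n r} (h : Fin n → Fin r) (q : Fin r → Bool) k →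
  (∀ s → q s ≡ true → k ≤ count (λ x → ⌊ h x ≟ s ⌋)) → count q * k ≤ count (q ∘ h)
count-fibres h q k large = begin
  count q * k
    ≡⟨ sym (sumF-indicator-* q k) ⟩
  sumF (λ s → indicator (q s) * k)
    ≤⟨ sumF-mono fibre ⟩
  sumF (λ s → count (λ x → ⌊ h x ≟ s ⌋ ∧ q s))
    ≡⟨ double-count (λ s x → ⌊ h x ≟ s ⌋ ∧ q s) ⟩
  sumF (λ x → count (λ s → ⌊ h x ≟ s ⌋ ∧ q s))
    ≤⟨ sumF-mono at-most-one ⟩
  sumF (λ x → indicator (q (h x)))
    ≡⟨ sumF-indicator (q ∘ h) ⟩
  count (q ∘ h) ∎
  where
  open ≤-Reasoning
  fibre : ∀ s → indicator (q s) * k ≤ count (λ x → ⌊ h x ≟ s ⌋ ∧ q s)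
  fibre s with q s in e
  ... | false = z≤n
  ... | true  = ≤-trans (≤-reflexive (+-identityʳ k))
                (≤-trans (large s e) (count-mono _ (λ x → ⌊ h x ≟ s ⌋ ∧ true) λ x f → ∧-intro f refl))
  at-most-one : ∀ x → count (λ s → ⌊ h x ≟ s ⌋ ∧ q s) ≤ indicator (q (h x))
  at-most-one x = count≤indicator _ _
    (λ {s} f → trans (cong q (⌊⌋-elim (h x ≟ s) (∧-elimˡ f))) (∧-elimʳ {⌊ h x ≟ s ⌋} f))
    (λ f g → trans (sym (⌊⌋-elim (h x ≟ _) (∧-elimˡ f))) (⌊⌋-elim (h x ≟ _) (∧-elimˡ g)))

interNum-positive : ∀ {n r} (col : Fin n → Fin n → Fin r) {a b g i j} →
  col a g ≡ i → col g b ≡ j → 0 < interNum col a b i j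
interNum-positive col {a} {b} {g} {i} {j} e f =
  count-positive (λ γ → ⌊ col a γ ≟ i ⌋ ∧ ⌊ col γ b ≟ j ⌋)
    (∧-intro (⌊⌋-intro (col a g ≟ i) e) (⌊⌋-intro (col g b ≟ j) f))

interNum-witness : ∀ {n r} (col : Fin n → Fin n → Fin r) {a b i j} →
  0 < interNum col a b i j → ∃[ g ] (col a g ≡ i × col g b ≡ j)
interNum-witness col {a} {b} {i} {j} pos =
  let g , e = count-witness (λ γ → ⌊ col a γ ≟ i ⌋ ∧ ⌊ col γ b ≟ j ⌋) pos
  in g , ⌊⌋-elim (col a g ≟ i) (∧-elimˡ e) , ⌊⌋-elim (col g b ≟ j) (∧-elimʳ {⌊ col a g ≟ i ⌋} e)

-- Generic points of a scheme

module Resolution {n r : ℕ} (X : CoherentConfiguration n r) where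
  open CoherentConfiguration X

  col-star : ∀ a b → col b a ≡ star (col a b)
  col-star a b = Equivalence.to (C2 (col a b) a b) refl

  col-reverse : ∀ {a b a′ b′} → col a b ≡ col a′ b′ → col b a ≡ col b′ a′
  col-reverse {a} {b} {a′} {b′} e = trans (col-star a b) (trans (cong star e) (sym (col-star a′ b′)))

  Resolves : Fin n → Fin n → Fin r → Set
  Resolves α β v = ∀ {x y} → col α x ≡ v → col α y ≡ v → col β x ≡ col β y → x ≡ y

  -- Count the pairs (η, ε) ∈ αs × αw with r(η, ε) = j, where s = r(α, σ) and w = r(α, μ).
  resolves-sym : ∀ {α σ μ k} → HasValency X (col α σ) k → HasValency X (col α μ) k →
    Resolves α μ (col α σ) → Resolves α σ (col α μ)
  resolves-sym {α} {σ} {μ} {k} s-val w-val μ-res {x} {y} x∈w y∈w σx≡σy with x ≟ y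
  ... | yes x≡y = x≡y
  ... | no x≢y = contradiction k*2≤k (<⇒≱ (m<m*n k 2 ⦃ >-nonZero k>0 ⦄ (s≤s (s≤s z≤n))))
    where
    s = col α σ
    w = col α μ
    j = col σ x
    R : Fin n → Fin n → Bool
    R η ε = (⌊ col α η ≟ s ⌋ ∧ ⌊ col η ε ≟ j ⌋) ∧ ⌊ col α ε ≟ w ⌋

    k>0 : 0 < k
    k>0 = subst (0 <_) (s-val α) (count-positive _ {σ} (⌊⌋-intro (col α σ ≟ s) refl))

    -- As `μ` resolves the fibre of `s`, at most one `η` in it sees `μ` in colour `j`. By `C3` the
    -- same holds for every `ε` in the fibre of `w`.
    at-μ : interNum col α μ s j ≤ 1
    at-μ = count≤1 _ λ {η} {η′} e e′ → μ-res
      (⌊⌋-elim (col α η ≟ s) (∧-elimˡ e)) (⌊⌋-elim (col α η′ ≟ s) (∧-elimˡ e′))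
      (col-reverse (trans (⌊⌋-elim (col η μ ≟ j) (∧-elimʳ {⌊ col α η ≟ s ⌋} e))
                     (sym (⌊⌋-elim (col η′ μ ≟ j) (∧-elimʳ {⌊ col α η′ ≟ s ⌋} e′)))))

    upper : ∀ ε → count (λ η → R η ε) ≤ indicator ⌊ col α ε ≟ w ⌋
    upper ε = count≤indicator _ _ (λ {η} e → ∧-elimʳ {⌊ col α η ≟ s ⌋ ∧ ⌊ col η ε ≟ j ⌋} e) unique
      where
      unique : ∀ {η η′} → R η ε ≡ true → R η′ ε ≡ true → η ≡ η′
      unique {η} {η′} e e′ with η ≟ η′
      ... | yes eq = eq
      ... | no neq = contradiction
        (≤-trans (count≥2 (λ η → ⌊ col α η ≟ s ⌋ ∧ ⌊ col η ε ≟ j ⌋) (∧-elimˡ e) (∧-elimˡ e′) neq)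
          (≤-trans (≤-reflexive (C3 s j α ε α μ
            (⌊⌋-elim (col α ε ≟ w) (∧-elimʳ {⌊ col α η ≟ s ⌋ ∧ ⌊ col η ε ≟ j ⌋} e)))) at-μ))
        λ { (s≤s ()) }

    -- For `η = σ` both `x` and `y` serve as `ε`, and `C3` carries this to all `k` points `η` of the
    -- fibre of `s`; the two counts collide.
    at-σ : 2 ≤ interNum col α σ w (star j)
    at-σ = count≥2 (λ ε → ⌊ col α ε ≟ w ⌋ ∧ ⌊ col ε σ ≟ star j ⌋)
      (∧-intro (⌊⌋-intro (col α x ≟ w) x∈w) (⌊⌋-intro (col x σ ≟ star j) (col-star σ x)))
      (∧-intro (⌊⌋-intro (col α y ≟ w) y∈w)
        (⌊⌋-intro (col y σ ≟ star j) (trans (col-star σ y) (cong star (sym σx≡σy)))))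
      x≢y

    lower : ∀ η → indicator ⌊ col α η ≟ s ⌋ * 2 ≤ count (R η)
    lower η with col α η ≟ s
    ... | no _ = z≤n
    ... | yes η∈s = ≤-trans at-σ (≤-trans (≤-reflexive (C3 w (star j) α σ α η (sym η∈s)))
      (count-mono (λ ε → ⌊ col α ε ≟ w ⌋ ∧ ⌊ col ε η ≟ star j ⌋) _ λ ε e →
        ∧-intro (⌊⌋-intro (col η ε ≟ j) (Equivalence.from (C2 j η ε)
                  (⌊⌋-elim (col ε η ≟ star j) (∧-elimʳ {⌊ col α ε ≟ w ⌋} e))))
                (∧-elimˡ e)))

    k*2≤k : k * 2 ≤ k
    k*2≤k = begin
      k * 2                                         ≡⟨ cong (_* 2) (sym (s-val α)) ⟩
      rowCount X α s * 2                            ≡⟨ sym (sumF-indicator-* (λ η → ⌊ col α η ≟ s ⌋) 2) ⟩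
      sumF (λ η → indicator ⌊ col α η ≟ s ⌋ * 2)    ≤⟨ sumF-mono lower ⟩
      sumF (λ η → count (R η))                      ≡⟨ double-count R ⟩
      sumF (λ ε → count (λ η → R η ε))              ≤⟨ sumF-mono upper ⟩
      sumF (λ ε → indicator ⌊ col α ε ≟ w ⌋)        ≡⟨ sumF-indicator (λ ε → ⌊ col α ε ≟ w ⌋) ⟩
      rowCount X α w                                ≡⟨ w-val α ⟩
      k ∎
      where open ≤-Reasoning

-- The form in which the pseudo-TI hypotheses enter. The bound on classes is turned into one on
-- points: from every `α`, the points of thick colour outnumber six obstruction lists.
record Abundant {n r : ℕ} (X : CoherentConfiguration n r) (d : Fin r) (k c : ℕ) : Set where
  open CoherentConfiguration X
  field
    diagonal       : IsDiagonalClass X d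
    valency≤       : ∀ s α → rowCount X α s ≤ k
    indist≤        : ∀ {a b} → a ≢ b → indistSum X a b ≤ c
    thick          : Fin r → Bool
    thick-valency  : ∀ s → thick s ≡ true → HasValency X s k
    thick-abundant : ∀ α → 6 * (k * ((k ∸ 1) * c)) < count (λ μ → thick (col α μ))

module Generic {n r : ℕ} {X : CoherentConfiguration n r} {d : Fin r} {k c : ℕ} (A : Abundant X d k c) where
  open CoherentConfiguration X
  open Abundant A
  open Resolution X

  -- The length allowed to one obstruction list: `k (k - 1)` choices, each of which rules out at
  -- most `c` points.
  unit : ℕ
  unit = k * ((k ∸ 1) * c)

  nbrs : Fin n → Fin r → List (Fin n)
  nbrs a v = filter (λ g → col a g ≟ v) (allFin n)

  ∈-nbrs : ∀ {a v g} → col a g ≡ v → g ∈ nbrs a v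
  ∈-nbrs {a} {v} {g} = ∈-filter⁺ (λ g → col a g ≟ v) (∈-allFin g)

  length-nbrs : ∀ a v → length (nbrs a v) ≤ k
  length-nbrs a v = ≤-trans (≤-reflexive (length-filter-tabulate (λ g → col a g ≟ v) (λ x → x))) (valency≤ v a)

  others : Fin n → Fin r → Fin n → List (Fin n)
  others a v g = filter (λ x → ¬? (x ≟ g)) (nbrs a v)

  ∈-others : ∀ {a v g x} → col a x ≡ v → x ≢ g → x ∈ others a v g
  ∈-others {g = g} e neq = ∈-filter⁺ (λ x → ¬? (x ≟ g)) (∈-nbrs e) neq

  length-others : ∀ {a v g} → col a g ≡ v → length (others a v g) ≤ k ∸ 1
  length-others {a} {v} {g} e = ∸-monoˡ-≤ 1 (≤-trans
    (filter-notAll (λ x → ¬? (x ≟ g)) (nbrs a v) (lose (∈-nbrs e) λ neq → neq refl))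
    (length-nbrs a v))

  -- Every `μ` would qualify when `a` and `b` coincide; making that case empty lets the bound `c`
  -- hold for all pairs.
  confused : Fin n → Fin n → List (Fin n)
  confused a b with a ≟ b
  ... | yes _ = []
  ... | no _  = filter (λ μ → col a μ ≟ col b μ) (allFin n)

  ∈-confused : ∀ {a b μ} → a ≢ b → col a μ ≡ col b μ → μ ∈ confused a b
  ∈-confused {a} {b} {μ} neq e with a ≟ b
  ... | yes eq = contradiction eq neq
  ... | no _   = ∈-filter⁺ (λ μ → col a μ ≟ col b μ) (∈-allFin μ) e

  -- If `s` is the common colour of `(a, μ)` and `(b, μ)`, then `(μ, b)` has colour `star s`, so the
  -- summand of `s` in `indistSum` counts `μ`.
  length-confused : ∀ a b → length (confused a b) ≤ c
  length-confused a b with a ≟ b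
  ... | yes _  = z≤n
  ... | no neq = begin
    length (filter (λ μ → col a μ ≟ col b μ) (allFin n))
      ≡⟨ length-filter-tabulate (λ μ → col a μ ≟ col b μ) (λ x → x) ⟩
    count (λ μ → ⌊ col a μ ≟ col b μ ⌋)
      ≡⟨ sym (sumF-indicator (λ μ → ⌊ col a μ ≟ col b μ ⌋)) ⟩
    sumF (λ μ → indicator ⌊ col a μ ≟ col b μ ⌋)
      ≤⟨ sumF-mono covered ⟩
    sumF (λ μ → count (λ s → R s μ))
      ≡⟨ sym (double-count R) ⟩
    indistSum X a b
      ≤⟨ indist≤ neq ⟩
    c ∎
    where
    open ≤-Reasoning
    R : Fin r → Fin n → Bool
    R s μ = ⌊ col a μ ≟ s ⌋ ∧ ⌊ col μ b ≟ star s ⌋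
    covered : ∀ μ → indicator ⌊ col a μ ≟ col b μ ⌋ ≤ count (λ s → R s μ)
    covered μ with col a μ ≟ col b μ
    ... | no _  = z≤n
    ... | yes e = count-positive (λ s → R s μ) {col a μ} (∧-intro
      (⌊⌋-intro (col a μ ≟ col a μ) refl)
      (⌊⌋-intro (col μ b ≟ star (col a μ)) (trans (col-star b μ) (cong star (sym e)))))

  generic-point : ∀ α (bs : List (List (Fin n))) → All (λ b → length b ≤ unit) bs → length bs ≤ 6 →
    ∃[ μ ] (HasValency X (col α μ) k × All (μ ∉_) bs)
  generic-point α bs small few =
    let μ , thick-μ , μ∉ = choose-outside (concatMap (λ b → b) bs) (λ μ → thick (col α μ)) few-points
    in μ , thick-valency (col α μ) thick-μ ,
       All.tabulate λ b∈bs μ∈b → μ∉ (∈-concatMap (λ b → b) b∈bs μ∈b)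
    where
    few-points : length (concatMap (λ b → b) bs) < count (λ μ → thick (col α μ))
    few-points = ≤-<-trans (length-concatMap-≤ (λ b → b) bs (All.lookup small))
      (≤-<-trans (*-monoˡ-≤ unit few) (thick-abundant α))

  unresolving : Fin n → Fin r → List (Fin n)
  unresolving α v = concatMap (λ x → concatMap (confused x) (others α v x)) (nbrs α v)

  length-unresolving : ∀ α v → length (unresolving α v) ≤ unit
  length-unresolving α v = ≤-trans
    (length-concatMap-≤ (λ x → concatMap (confused x) (others α v x)) (nbrs α v) λ {x} x∈ →
      ≤-trans (length-concatMap-≤ (confused x) (others α v x) λ {y} _ → length-confused x y)
        (*-monoˡ-≤ c (length-others (proj₂ (∈-filter⁻ (λ g → col α g ≟ v) {xs = allFin n} x∈)))))
    (*-monoˡ-≤ ((k ∸ 1) * c) (length-nbrs α v))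

  -- A failure would be a pair of distinct points of the fibre confused by `μ`, and `unresolving`
  -- runs over all these pairs.
  resolves-generic : ∀ {α v μ} → μ ∉ unresolving α v → Resolves α μ v
  resolves-generic {α} {v} μ∉ {x} {y} x∈v y∈v e with x ≟ y
  ... | yes x≡y = x≡y
  ... | no x≢y = contradiction
    (∈-concatMap (λ x → concatMap (confused x) (others α v x)) (∈-nbrs x∈v)
      (∈-concatMap (confused x) (∈-others y∈v (x≢y ∘ sym)) (∈-confused x≢y (col-reverse e))))
    μ∉

  -- Outside this list, the colours of αγ, βγ, αμ and βμ determine that of γμ,
  -- provided that β resolves the α-fibre of γ.
  far-ambiguous : Fin n → Fin n → Fin n → List (Fin n)
  far-ambiguous α β γ =
    concatMap (λ x → concatMap (confused x) (others β (col β γ) γ)) (nbrs α (col α γ))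

  length-far-ambiguous : ∀ α β γ → length (far-ambiguous α β γ) ≤ unit
  length-far-ambiguous α β γ = ≤-trans
    (length-concatMap-≤ (λ x → concatMap (confused x) (others β (col β γ) γ)) (nbrs α (col α γ)) λ {x} _ →
      ≤-trans (length-concatMap-≤ (confused x) (others β (col β γ) γ) λ {y} _ → length-confused x y)
        (*-monoˡ-≤ c (length-others refl)))
    (*-monoˡ-≤ ((k ∸ 1) * c) (length-nbrs α (col α γ)))

  -- Outside this list, the colours of αβ, αδ, βμ and δμ determine that of βδ.
  near-ambiguous : Fin n → Fin n → Fin n → List (Fin n)
  near-ambiguous α β δ =
    concatMap (λ x → concatMap (confused δ) (nbrs β (col β x))) (others α (col α δ) δ)

  length-near-ambiguous : ∀ α β δ → length (near-ambiguous α β δ) ≤ unit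
  length-near-ambiguous α β δ = begin
    length (near-ambiguous α β δ)
      ≤⟨ length-concatMap-≤ (λ x → concatMap (confused δ) (nbrs β (col β x))) (others α (col α δ) δ) (λ {x} _ →
           ≤-trans (length-concatMap-≤ (confused δ) (nbrs β (col β x)) λ {y} _ → length-confused δ y)
             (*-monoˡ-≤ c (length-nbrs β (col β x)))) ⟩
    length (others α (col α δ) δ) * (k * c)
      ≤⟨ *-monoˡ-≤ (k * c) (length-others refl) ⟩
    (k ∸ 1) * (k * c)
      ≡⟨ x∙yz≈y∙xz (k ∸ 1) k c ⟩
    unit ∎
    where
    open ≤-Reasoning

-- Points matched under an algebraic isomorphism

module Matching {n r n′ r′ : ℕ} {X : CoherentConfiguration n r} {X′ : CoherentConfiguration n′ r′} {d : Fin r} {k c : ℕ} (A : Abundant X d k c) (φ : Permutation r r′) (φ-iso : IsAlgebraicIso X X′ φ) where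
  open CoherentConfiguration X
  open CoherentConfiguration X′ using () renaming (col to col′; C1 to C1′)
  open Abundant A
  open Resolution X
  open Resolution X′ using () renaming (col-reverse to col-reverse′)
  open Generic A

  Matched : Fin n → Fin n → Fin n′ → Fin n′ → Set
  Matched a b a′ b′ = col′ a′ b′ ≡ φ ⟨$⟩ʳ col a b

  φ-injective : ∀ {i j} → φ ⟨$⟩ʳ i ≡ φ ⟨$⟩ʳ j → i ≡ j
  φ-injective e = trans (sym (inverseˡ φ)) (trans (cong (φ ⟨$⟩ˡ_) e) (inverseˡ φ))

  -- The triangle through `g` makes an intersection number positive; `φ` preserves that number, so a
  -- triangle of the image colours stands over `(a′, b′)`.
  transfer : ∀ {a b a′ b′} → Matched a b a′ b′ → ∀ g → ∃[ g′ ] (Matched a g a′ g′ × Matched g b g′ b′)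
  transfer {a} {b} {a′} {b′} ab g = interNum-witness col′
    (subst (0 <_) (φ-iso (col a g) (col g b) (col a b) a b a′ b′ refl ab) (interNum-positive col refl refl))

  transfer⁻ : ∀ {a b a′ b′} → Matched a b a′ b′ → ∀ g′ → ∃[ g ] (Matched a g a′ g′ × Matched g b g′ b′)
  transfer⁻ {a} {b} {a′} {b′} ab g′ =
    let i = φ ⟨$⟩ˡ col′ a′ g′
        j = φ ⟨$⟩ˡ col′ g′ b′
        g , e , f = interNum-witness col
          (subst (0 <_) (sym (φ-iso i j (col a b) a b a′ b′ refl ab))
            (interNum-positive col′ (sym (inverseʳ φ)) (sym (inverseʳ φ))))
    in g , trans (sym (inverseʳ φ)) (cong (φ ⟨$⟩ʳ_) (sym e)) ,
           trans (sym (inverseʳ φ)) (cong (φ ⟨$⟩ʳ_) (sym f))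

  col-diagonal : ∀ a → col a a ≡ d
  col-diagonal a = Equivalence.from (diagonal a a) refl

  -- Let `φ` send the colour of `(x, y)` to that of `(a′, a′)`. Transferring the degenerate triangle
  -- `x, x, y` yields a point that `C1′` identifies with `a′`, so the colour of `(a′, a′)` is the
  -- image of a diagonal one. Hence `X′` is homogeneous too.
  matched-diagonal : ∀ a a′ → Matched a a a′ a′
  matched-diagonal a a′ =
    let x , y , xy = surj (φ ⟨$⟩ˡ col′ a′ a′)
        x′y′ = trans (sym (inverseʳ φ)) (cong (φ ⟨$⟩ʳ_) (sym xy))
        g′ , xx , xg′ = transfer {x} {y} {a′} {a′} x′y′ x
        g′≡a′ = C1′ g′ a′ a′ (trans xg′ (sym x′y′))
    in trans (trans (cong (col′ a′) (sym g′≡a′)) xx)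
         (cong (φ ⟨$⟩ʳ_) (trans (col-diagonal x) (sym (col-diagonal a))))

  matched-functional : ∀ {a a′ b′} → Matched a a a′ b′ → a′ ≡ b′
  matched-functional {a} {a′} {b′} e = C1′ a′ b′ a′ (trans e (sym (matched-diagonal a a′)))

  matched-injective : ∀ {a b a′} → Matched a b a′ a′ → a ≡ b
  matched-injective {a} {b} {a′} e = Equivalence.to (diagonal a b)
    (trans (φ-injective (trans (sym e) (matched-diagonal a a′))) (col-diagonal a))

  -- Transfer `b` over the diagonal pair `(a, a)`: the point `b″` obtained is matched both ways, and
  -- `(a′, b″)` has the colour of `(a′, b′)`.
  matched-sym : ∀ {a b a′ b′} → Matched a b a′ b′ → Matched b a b′ a′
  matched-sym {a} {b} {a′} {b′} e =
    let b″ , f , g = transfer (matched-diagonal a a′) b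
    in trans (col-reverse′ (trans e (sym f))) g

  -- Pulling `γ′` back over `(α, μ)` and over `(β, μ)` gives `x` and `y` of equal colour to `μ`. If
  -- `y` is `γ`, the claim follows. If `x ≡ y` is another point, `β` fails to resolve the fibre of
  -- `γ`; if `x` and `y` differ, `μ` confuses them and is on the list.
  matched-far : ∀ {α β γ μ α′ β′ γ′ μ′} → Resolves α β (col α γ) → μ ∉ far-ambiguous α β γ →
    Matched α γ α′ γ′ → Matched β γ β′ γ′ → Matched α μ α′ μ′ → Matched β μ β′ μ′ →
    Matched γ μ γ′ μ′
  matched-far {α} {β} {γ} {μ} {α′} {β′} {γ′} {μ′} res μ∉ αγ βγ αμ βμ =
    let x , αx , xμ = transfer⁻ αμ γ′
        y , βy , yμ = transfer⁻ βμ γ′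
        αx≡αγ = φ-injective (trans (sym αx) αγ)
        βy≡βγ = φ-injective (trans (sym βy) βγ)
    in case x y αx≡αγ βy≡βγ xμ (φ-injective (trans (sym xμ) yμ)) (y ≟ γ) (x ≟ y)
    where
    case : ∀ x y → col α x ≡ col α γ → col β y ≡ col β γ → Matched x μ γ′ μ′ → col x μ ≡ col y μ →
      Dec (y ≡ γ) → Dec (x ≡ y) → Matched γ μ γ′ μ′
    case x y αx βy xμ e (yes refl) _ = trans xμ (cong (φ ⟨$⟩ʳ_) e)
    case x y αx βy xμ e (no y≢γ) (yes refl) = contradiction (res αx refl βy) y≢γ
    case x y αx βy xμ e (no y≢γ) (no x≢y) = contradiction
      (∈-concatMap (λ x → concatMap (confused x) (others β (col β γ) γ)) (∈-nbrs αx)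
        (∈-concatMap (confused x) (∈-others βy y≢γ) (∈-confused x≢y e)))
      μ∉

  -- Pull `δ′` back over `(α, β)` to `x`, and over `(β, μ)` to `y`. Both have from `β` the colour
  -- wanted for `δ`, so it suffices that `δ` is one of them; otherwise `μ` confuses `δ` and `y`.
  matched-near : ∀ {α β δ μ α′ β′ δ′ μ′} → μ ∉ near-ambiguous α β δ →
    Matched α β α′ β′ → Matched α δ α′ δ′ → Matched β μ β′ μ′ → Matched δ μ δ′ μ′ →
    Matched β δ β′ δ′
  matched-near {α} {β} {δ} {μ} {α′} {β′} {δ′} {μ′} μ∉ αβ αδ βμ δμ =
    let x , αx , xβ = transfer⁻ αβ δ′
        y , βy , yμ = transfer⁻ βμ δ′
        βx = matched-sym xβ
    in case x y (φ-injective (trans (sym αx) αδ)) βx (φ-injective (trans (sym βy) βx))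
         (φ-injective (trans (sym δμ) yμ)) (x ≟ δ) (δ ≟ y)
    where
    case : ∀ x y → col α x ≡ col α δ → Matched β x β′ δ′ → col β y ≡ col β x → col δ μ ≡ col y μ →
      Dec (x ≡ δ) → Dec (δ ≡ y) → Matched β δ β′ δ′
    case x y αx βx βy e (yes refl) _ = βx
    case x y αx βx βy e (no x≢δ) (yes refl) = trans βx (cong (φ ⟨$⟩ʳ_) (sym βy))
    case x y αx βx βy e (no x≢δ) (no δ≢y) = contradiction
      (∈-concatMap (λ x → concatMap (confused δ) (nbrs β (col β x))) (∈-others αx x≢δ)
        (∈-concatMap (confused δ) (∈-nbrs βy) (∈-confused δ≢y e)))
      μ∉

  -- A generic `μ` is carried along the chain: `matched-far` takes it from `β` to `γ`, then from `γ`
  -- to `δ`, and `matched-near` closes the triangle `β, δ, μ`.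
  matched-trans : ∀ {α β γ δ α′ β′ γ′ δ′} → Resolves α β (col α γ) → Resolves α γ (col α δ) →
    Matched α β α′ β′ → Matched α γ α′ γ′ → Matched α δ α′ δ′ →
    Matched β γ β′ γ′ → Matched γ δ γ′ δ′ → Matched β δ β′ δ′
  matched-trans {α} {β} {γ} {δ} β-res γ-res αβ αγ αδ βγ γδ
    with generic-point α (far-ambiguous α β γ ∷ far-ambiguous α γ δ ∷ near-ambiguous α β δ ∷ [])
           (length-far-ambiguous α β γ ∷ length-far-ambiguous α γ δ ∷ length-near-ambiguous α β δ ∷ [])
           (m≤m+n 3 3)
  ... | μ , _ , far-βγ ∷ far-γδ ∷ near-βδ ∷ [] =
    let μ′ , αμ , μβ = transfer αβ μ
        βμ = matched-sym μβ
        γμ = matched-far β-res far-βγ αγ βγ αμ βμ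
        δμ = matched-far γ-res far-γδ αδ γδ αμ γμ
    in matched-near near-βδ αβ αδ βμ δμ

  -- Extending a matched pair of valency k to an isomorphism

  module Extension {α σ : Fin n} {α′ σ′ : Fin n′} (ασ : Matched α σ α′ σ′) (σ-val : HasValency X (col α σ) k) where

    -- The last component lets `ν` stand in for `σ`: what is matched as seen from `σ` is also
    -- matched as seen from `ν`.
    Anchored : Fin n → Fin n′ → Set
    Anchored ν ν′ = HasValency X (col α ν) k × Matched α ν α′ ν′ ×
      (∀ {μ μ′} → Matched α μ α′ μ′ → Matched σ μ σ′ μ′ → Resolves α σ (col α μ) → Matched ν μ ν′ μ′)

    anchored-base : Anchored σ σ′
    anchored-base = σ-val , ασ , λ _ σμ _ → σμ

    -- Apply `matched-trans` to the chain `ν, σ, μ`.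
    anchored : ∀ {ν ν′} → HasValency X (col α ν) k → Resolves α ν (col α σ) →
      Matched α ν α′ ν′ → Matched ν σ ν′ σ′ → Anchored ν ν′
    anchored ν-val ν-res αν νσ = ν-val , αν , λ αμ σμ σ-res → matched-trans ν-res σ-res αν ασ αμ νσ σμ

    -- The graph of the isomorphism to be built. Being a relation, it can be entered from either
    -- side, and the anchor may vary with the point.
    record Linked (γ : Fin n) (γ′ : Fin n′) : Set where
      constructor linked
      field
        {ν}      : Fin n
        {ν′}     : Fin n′
        anchor   : Anchored ν ν′
        resolves : Resolves α ν (col α γ)
        αγ       : Matched α γ α′ γ′
        νγ       : Matched ν γ ν′ γ′

    -- The two anchors may differ, so one generic `μ` joins them: the chains `μ, ν, γ` and `μ, ρ, δ`
    -- match `μ` with `γ` and with `δ`, and `matched-near` closes the triangle.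
    linked-matched : ∀ {γ δ γ′ δ′} → Linked γ γ′ → Linked δ δ′ → Matched γ δ γ′ δ′
    linked-matched {γ} {δ} (linked {ν} (ν-val , αν , ν-anchor) ν-res αγ νγ) (linked {ρ} (ρ-val , αρ , ρ-anchor) ρ-res αδ ρδ)
      with generic-point α
             (unresolving α (col α σ) ∷ unresolving α (col α ν) ∷ unresolving α (col α ρ) ∷ near-ambiguous α γ δ ∷ [])
             (length-unresolving α _ ∷ length-unresolving α _ ∷ length-unresolving α _ ∷ length-near-ambiguous α γ δ ∷ [])
             (m≤m+n 4 2)
    ... | μ , μ-val , σ∉ ∷ ν∉ ∷ ρ∉ ∷ near ∷ [] =
      let μ′ , αμ , μσ = transfer ασ μ
          σμ = matched-sym μσ
          -- Genericity only makes `μ` resolve the fibre of `σ`; the anchors ask for the converse,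
          -- available because both colours have valency `k`.
          σ-res = resolves-sym σ-val μ-val (resolves-generic σ∉)
          μν = matched-sym (ν-anchor αμ σμ σ-res)
          μρ = matched-sym (ρ-anchor αμ σμ σ-res)
          μγ = matched-trans (resolves-generic ν∉) ν-res αμ αν αγ μν νγ
          μδ = matched-trans (resolves-generic ρ∉) ρ-res αμ αρ αδ μρ ρδ
      in matched-near near αγ αδ (matched-sym μγ) (matched-sym μδ)

    anchored-resolving : ∀ v → ∃₂ λ ν ν′ → Anchored ν ν′ × Resolves α ν v
    anchored-resolving v
      with generic-point α (unresolving α (col α σ) ∷ unresolving α v ∷ [])
             (length-unresolving α _ ∷ length-unresolving α _ ∷ []) (m≤m+n 2 4)
    ... | ν , ν-val , σ∉ ∷ v∉ ∷ [] =
      let ν′ , αν , νσ = transfer ασ ν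
      in ν , ν′ , anchored ν-val (resolves-generic σ∉) αν νσ , resolves-generic v∉

    link : ∀ γ → ∃[ γ′ ] Linked γ γ′
    link γ =
      let ν , ν′ , anchor@(_ , αν , _) , res = anchored-resolving (col α γ)
          γ′ , αγ , γν = transfer αν γ
      in γ′ , linked anchor res αγ (matched-sym γν)

    link⁻ : ∀ γ′ → ∃[ γ ] Linked γ γ′
    link⁻ γ′ =
      -- The anchor has to be chosen before `γ` exists, so it resolves the preimage of the colour of
      -- `(α′, γ′)`, which turns out to be that of `(α, γ)`.
      let ν , ν′ , anchor@(_ , αν , _) , res = anchored-resolving (φ ⟨$⟩ˡ col′ α′ γ′)
          γ , αγ , γν = transfer⁻ αν γ′
          v≡αγ = trans (cong (φ ⟨$⟩ˡ_) αγ) (inverseˡ φ)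
      in γ , linked anchor (subst (Resolves α ν) v≡αγ res) αγ (matched-sym γν)

    -- Comparing `γ` with itself matches `(γ, γ)` with `(γ′, γ″)`, so the image does not depend on
    -- the anchor.
    linked-functional : ∀ {γ γ′ γ″} → Linked γ γ′ → Linked γ γ″ → γ′ ≡ γ″
    linked-functional l l′ = matched-functional (linked-matched l l′)

    linked-injective : ∀ {γ δ γ′} → Linked γ γ′ → Linked δ γ′ → γ ≡ δ
    linked-injective l l′ = matched-injective (linked-matched l l′)

    isomorphism : Permutation n n′
    isomorphism = permutation (proj₁ ∘ link) (proj₁ ∘ link⁻)
      (λ γ′ → linked-functional (proj₂ (link _)) (proj₂ (link⁻ γ′)))
      (λ γ → linked-injective (proj₂ (link⁻ _)) (proj₂ (link γ)))

    isomorphism-matched : ∀ γ δ → Matched γ δ (isomorphism ⟨$⟩ʳ γ) (isomorphism ⟨$⟩ʳ δ)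
    isomorphism-matched γ δ = linked-matched (proj₂ (link γ)) (proj₂ (link δ))

    isomorphism-base : isomorphism ⟨$⟩ʳ α ≡ α′
    isomorphism-base = sym (matched-functional (Linked.αγ (proj₂ (link α))))

    -- Here `σ` is itself an anchor resolving the fibre of `β`, so it links `β` to the prescribed
    -- `β′`.
    isomorphism-resolved : ∀ {β β′} → Resolves α σ (col α β) →
      Matched α β α′ β′ → Matched σ β σ′ β′ → isomorphism ⟨$⟩ʳ β ≡ β′
    isomorphism-resolved {β} res αβ σβ =
      linked-functional (proj₂ (link β)) (linked anchored-base res αβ σβ)

-- From the bound on the rank to abundance

≡ᵇ-intro : ∀ {i j} → i ≡ j → (i ≡ᵇ j) ≡ true
≡ᵇ-intro {i} {j} e = Equivalence.to Bool.T-≡ (≡⇒≡ᵇ i j e)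

allF-intro : ∀ {n} {p : Fin n → Bool} → (∀ x → p x ≡ true) → allF p ≡ true
allF-intro {zero}  h = refl
allF-intro {suc n} h = ∧-intro (h zero) (allF-intro (h ∘ suc))

pseudoTI-abundant : ∀ {n r} (X : CoherentConfiguration n r) {d k c m} →
  IsPseudoTI X d k c m → m + 6 * c * (k ∸ 1) < r → Abundant X d k c
pseudoTI-abundant {n} {r} X {d} {k} {c} {m} (diagonal , (valency≤ , _) , (indist≤ , _) , m≡ , valencies , _) large = record
  { diagonal       = diagonal
  ; valency≤       = valency≤
  ; indist≤        = λ {a} {b} a≢b → indist≤ a b (a≢b ∘ Equivalence.to (diagonal a b))
  ; thick          = not ∘ thin
  ; thick-valency  = thick-valency
  ; thick-abundant = thick-abundant
  }
  where
  open CoherentConfiguration X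
  -- The predicate counted by `numValencyOne`, so that `count thin` is that number by definition.
  thin : Fin r → Bool
  thin s = allF (λ α → rowCount X α s ≡ᵇ 1)

  thick-valency : ∀ s → not (thin s) ≡ true → HasValency X s k
  thick-valency s e with valencies s
  ... | inj₂ val-k = val-k
  ... | inj₁ val-1 = contradiction
    (trans (sym (cong not (allF-intro {p = λ α → rowCount X α s ≡ᵇ 1} λ α → ≡ᵇ-intro (val-1 α)))) e) λ ()

  rank-large : 6 * c * (k ∸ 1) < count (not ∘ thin)
  rank-large = +-cancelˡ-< m _ _
    (≤-trans large (≤-reflexive (trans (sym (count-not thin)) (cong (_+ count (not ∘ thin)) (sym m≡)))))

  -- More than `6c(k - 1)` classes are thick, and each contributes `k` points seen from `α`.
  thick-abundant : ∀ α → 6 * (k * ((k ∸ 1) * c)) < count (λ μ → not (thin (col α μ)))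
  thick-abundant α = begin-strict
    6 * (k * ((k ∸ 1) * c))       ≡⟨ cong (6 *_) (trans (cong (k *_) (*-comm (k ∸ 1) c)) (*-comm k _)) ⟩
    6 * (c * (k ∸ 1) * k)         ≡⟨ sym (*-assoc 6 (c * (k ∸ 1)) k) ⟩
    6 * (c * (k ∸ 1)) * k         ≡⟨ cong (_* k) (sym (*-assoc 6 c (k ∸ 1))) ⟩
    6 * c * (k ∸ 1) * k           <⟨ *-monoˡ-< k ⦃ >-nonZero k>0 ⦄ rank-large ⟩
    count (not ∘ thin) * k        ≤⟨ count-fibres (col α) (not ∘ thin) k (λ s e → ≤-reflexive (sym (thick-valency s e α))) ⟩
    count (λ μ → not (thin (col α μ))) ∎
    where
    open ≤-Reasoning
    k>0 : 0 < k
    k>0 = ≤-trans (count-positive (λ γ → ⌊ col α γ ≟ col α α ⌋) (⌊⌋-intro (col α α ≟ col α α) refl))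
                  (valency≤ (col α α) α)

-- Separability and schurity

module _ {n r : ℕ} {X : CoherentConfiguration n r} {d : Fin r} {k c : ℕ} (A : Abundant X d k c) where
  open CoherentConfiguration X
  open Generic A

  abundant-separable : Fin n → Separable X
  abundant-separable α n′ r′ X′ φ φ-iso =
    let σ , σ-val , _ = generic-point α [] [] z≤n
        -- Any pair of the image colour will do as the starting pair in `X′`.
        α′ , σ′ , ασ = CoherentConfiguration.surj X′ (φ ⟨$⟩ʳ col α σ)
        open Matching.Extension {X′ = X′} A φ φ-iso ασ σ-val
    in isomorphism , isomorphism-matched

  automorphisms : PermGroup X
  automorphisms = record
    { mem    = λ g → ∀ a b → col (g ⟨$⟩ʳ a) (g ⟨$⟩ʳ b) ≡ col a b
    ; mem-id = λ _ _ → refl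
    ; mem-∘  = λ g h g∈ h∈ a b → trans (h∈ (g ⟨$⟩ʳ a) (g ⟨$⟩ʳ b)) (g∈ a b)
    ; mem-⁻¹ = λ g g∈ a b → trans (sym (g∈ (g ⟨$⟩ˡ a) (g ⟨$⟩ˡ b))) (cong₂ col (inverseʳ g) (inverseʳ g))
    }

  -- The group is the full automorphism group; transitivity on each class comes from matching with
  -- `φ = id`, an algebraic isomorphism by `C3`.
  abundant-schurian : Schurian X
  abundant-schurian = automorphisms , λ α β α′ β′ → mk⇔ (move α β α′ β′)
    λ { (g , g∈ , refl , refl) → sym (g∈ α β) }
    where
    id-iso : IsAlgebraicIso X X id
    id-iso i j t a b a′ b′ ab a′b′ = CoherentConfiguration.C3 X i j a b a′ b′ (trans ab (sym a′b′))
    open Matching {X′ = X} A id id-iso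

    move : ∀ α β α′ β′ → col α β ≡ col α′ β′ →
      ∃[ g ] (PermGroup.mem automorphisms g × (g ⟨$⟩ʳ α ≡ α′) × (g ⟨$⟩ʳ β ≡ β′))
    -- Choosing `σ` to resolve the fibre of `β` forces the isomorphism to send `β` to `β′`, besides
    -- `α` to `α′`.
    move α β α′ β′ e with generic-point α (unresolving α (col α β) ∷ []) (length-unresolving α _ ∷ []) (m≤m+n 1 5)
    ... | σ , σ-val , β∉ ∷ [] =
      let σ′ , ασ , σβ = transfer (sym e) σ
          open Extension ασ σ-val
      in isomorphism , isomorphism-matched , isomorphism-base ,
         isomorphism-resolved (resolves-generic β∉) (sym e) σβ

theorem1p3 : ∀ (n r : ℕ) (X : CoherentConfiguration n r) (d : Fin r) (k c m : ℕ) →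
    IsPseudoTI X d k c m →
    m + 6 * c * (k ∸ 1) < r →
    Schurian X × Separable X
theorem1p3 n r X d k c m pti large =
  let A = pseudoTI-abundant X pti large
  -- The class `d` is nonempty, which supplies a base point.
  in abundant-schurian A , abundant-separable A (proj₁ (CoherentConfiguration.surj X d))
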